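{- Let $G(V,E)$ be an $n$-vertex graph, let $k\ge 1$ be an integer, and assume $\mathrm{MM}(G)=\omega(k\log n)$, where $\mathrm{MM}(G)$ denotes the maximum matching size of $G$. Let $\mathsf{ALG}$ be any algorithm that, given a graph $H$, outputs an arbitrary maximum matching of $H$ (viewed as a subgraph of $H$). Then $\mathsf{ALG}$ is an $O(1)$-approximation randomized composable coreset of size $O(n)$ for the maximum matching problem; that is, if $G^{(1)},\dots,G^{(k)}$ is a random $k$-partitioning of $G$, then with high probability over the partitioning, the graph $\mathsf{ALG}(G^{(1)})\cup\dots\cup\mathsf{ALG}(G^{(k)})$ contains a matching of size at least $\mathrm{MM}(G)/C$ for an absolute constant $C$.
   Context: A random $k$-partitioning of the edge set $E$ of a graph $G(V,E)$ is obtained by assigning each edge of $E$ independently to one of $k$ sets $E^{(1)},\dots,E^{(k)}$ chosen uniformly at random; $G^{(i)}:=G(V,E^{(i)})$. For a graph problem $P$, an algorithm $\mathsf{ALG}$ that outputs a subgraph $\mathsf{ALG}(H)\subseteq H$ with at most $s$ edges is an $\alpha$-approximation randomized composable coreset of size $s$ for $P$ if, for a random $k$-partitioning $G^{(1)},\dots,G^{(k)}$ of $G$, $P(\mathsf{ALG}(G^{(1)})\cup\dots\cup\mathsf{ALG}(G^{(k)}))$ is an $\alpha$-approximation of $P(G)$ with high probability over the partitioning. Throughout, the paper assumes $\mathrm{MM}(G)=\omega(k\log n)$. -}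

module Defs where

open import Data.Nat using (ℕ; zero; suc; _+_; _*_; _<_; _≤_; _⊔_; _^_)
open import Data.Nat.Logarithm using (⌊log₂_⌋)
open import Data.Fin using (Fin; toℕ; _≟_)
open import Data.Bool using (Bool; true; false; _∧_; not; if_then_else_)
open import Data.Product using (_×_; _,_)
open import Data.List using (List; []; _∷_; length; map; filter; foldr; concatMap; allFin; _++_)
open import Data.List.Relation.Unary.All using (All)
open import Data.List.Relation.Unary.Unique.Propositional using (Unique)
open import Data.List.Relation.Binary.Sublist.Propositional using (_⊆_)
open import Data.Vec using (Vec; []; _∷_)
open import Relation.Nullary.Decidable using (⌊_⌋)
open import Relation.Binary.PropositionalEquality using (_≡_)

Edge : ℕ → Set
Edge n = Fin n × Fin n

-- A simple graph on Fin n, given by its edge list: every edge (u , v)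
-- has u < v (no loops, canonical orientation) and no edge is repeated.
record Graph (n : ℕ) : Set where
  constructor graph
  field
    edges    : List (Edge n)
    ordered  : All (λ e → toℕ (Data.Product.proj₁ e) < toℕ (Data.Product.proj₂ e)) edges
    distinct : Unique edges
open Graph public

disjointE : ∀ {n} → Edge n → Edge n → Bool
disjointE (a , b) (c , d) =
  not ⌊ a ≟ c ⌋ ∧ not ⌊ a ≟ d ⌋ ∧ not ⌊ b ≟ c ⌋ ∧ not ⌊ b ≟ d ⌋

disjointAll : ∀ {n} → Edge n → List (Edge n) → Bool
disjointAll e []      = true
disjointAll e (f ∷ M) = disjointE e f ∧ disjointAll e M

isMatching : ∀ {n} → List (Edge n) → Bool
isMatching []      = true
isMatching (e ∷ M) = disjointAll e M ∧ isMatching M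

subsequences : ∀ {A : Set} → List A → List (List A)
subsequences []      = [] ∷ []
subsequences (x ∷ xs) = let r = subsequences xs in r ++ map (x ∷_) r

MM : ∀ {n} → List (Edge n) → ℕ
MM H = foldr _⊔_ 0 (map length (filter (λ M → isMatching M Data.Bool.≟ true) (subsequences H)))

IsMaxMatching : ∀ {n} → List (Edge n) → List (Edge n) → Set
IsMaxMatching H M = (M ⊆ H) × (isMatching M ≡ true) × (length M ≡ MM H)

-- all assignments of m items (edges) to k parts: the sample space of a
-- random k-partitioning (uniform distribution over this list)
assignments : (k m : ℕ) → List (Vec (Fin k) m)
assignments k zero    = [] ∷ []
assignments k (suc m) = concatMap (λ i → map (i ∷_) (assignments k m)) (allFin k)

part : ∀ {n k} (E : List (Edge n)) → Vec (Fin k) (length E) → Fin k → List (Edge n)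
part []      []      i = []
part (e ∷ E) (j ∷ p) i = if ⌊ j ≟ i ⌋ then e ∷ part E p i else part E p i

coresetUnion : ∀ {n k} → (List (Edge n) → List (Edge n)) →
               (E : List (Edge n)) → Vec (Fin k) (length E) → List (Edge n)
coresetUnion {k = k} ALG E p = concatMap (λ i → ALG (part E p i)) (allFin k)

badCount : ∀ {n} (k C : ℕ) → (List (Edge n) → List (Edge n)) → List (Edge n) → ℕ
badCount k C ALG E =
  length (filter (λ p → C * MM (coresetUnion ALG E p) Data.Nat.<? MM E)
                 (assignments k (length E)))

totalCount : ∀ {n} (k : ℕ) → List (Edge n) → ℕ
totalCount k E = length (assignments k (length E))

{-# OPTIONS --safe #-}

-- Fix a maximum matching M* = ALG E of size m and condition on the labels of all other edges.
-- The labels of M* are then revealed one label i at a time, while a matching M inside the union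
-- is extended greedily by the edges of ALG (part i) free of M.  Let N₀ be a maximum matching of
-- the edges outside M* with label i that touch M.  At most 6 |M| edges of M* conflict with M ++ N₀,
-- and which ones does not depend on the set S of edges of M* that receive the label i.  If f edges
-- of S conflict, then N₀ and the rest of S form a matching of part i, while ALG (part i) has at
-- most |N₀| + f edges touching M; so M grows by at least |S| − 2f.
-- Leave the last h = ⌊k/2⌋ labels unrevealed, and put D b = (b+1)(b+2)(b+3).  By induction on the
-- number j of labels still to be revealed, the number N of labellings of the r unrevealed edges
-- that keep |M| ≤ s satisfies, with b = j + 2h,
--   N 2^(r+|M|) ≤ 2^s (D b / D (2h))^(6s) b^r;
-- D is chosen so that D (b+1) / D b = (4+b) / (1+b) is the cost of one conflicting edge.
-- Initially b = k + h ≤ 3k/2 and D b ≤ 8 D (2h), so the fraction of labellings that are bad for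
-- s = m/190 is at most 2^(19s) (3/4)^m, and this is at most n^(−c) once m ≥ 20 c log n.
module Submission where

open import Defs
open import Data.Bool using (Bool; true; _∧_; if_then_else_)
import Data.Bool as Bool
open import Data.Fin using (Fin; zero; suc)
import Data.Fin as Fin
import Data.Fin.Properties as Fin
open import Data.List using (List; []; _∷_; [_]; length; lookup; map; filter; foldr; concatMap; allFin; take; drop; _++_)
open import Data.List.Properties using (length-++; length-map; length-tabulate; length-take; length-drop; take++drop≡id; filter-all; filter-none; filter-accept; filter-reject; concatMap-++; ++-identityʳ; ++-assoc)
import Data.List.Membership.DecPropositional as DecMembership
open import Data.List.Membership.Propositional using (_∈_; _∉_)
open import Data.List.Membership.Propositional.Properties using (∈-++⁺ˡ; ∈-++⁺ʳ; ∈-map⁺; ∈-filter⁺; ∈-filter⁻; ∈-lookup; ∈-∃++)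
open import Data.List.Relation.Binary.Permutation.Propositional using (_↭_; prep; ↭-refl; ↭-trans; ↭⇒↭ₛ)
open import Data.List.Relation.Binary.Permutation.Propositional.Properties using (shift; All-resp-↭; ↭-length)
import Data.List.Relation.Binary.Permutation.Setoid.Properties as ↭ₛ
open import Data.List.Relation.Binary.Sublist.Propositional using (_⊆_; []; _∷_; _∷ʳ_; ⊆-refl) renaming (lookup to ⊆-lookup)
import Data.List.Relation.Binary.Sublist.Propositional.Properties as Sublist
open import Data.List.Relation.Unary.All as All using (All; []; _∷_)
import Data.List.Relation.Unary.All.Properties as All
open import Data.List.Relation.Unary.AllPairs as AllPairs using (AllPairs; []; _∷_)
import Data.List.Relation.Unary.AllPairs.Properties as AllPairs
open import Data.List.Relation.Unary.Any using (here; there)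
open import Data.List.Relation.Unary.Unique.Propositional using (Unique)
open import Data.List.Relation.Unary.Unique.Propositional.Properties using (allFin⁺; Unique[x∷xs]⇒x∉xs)
open import Data.Maybe using (Maybe; just; nothing)
open import Data.Nat using (ℕ; zero; suc; _+_; _*_; _∸_; _^_; _⊔_; _⊓_; _≤_; _<_; _≤?_; _<?_; z≤n; s≤s; NonZero; >-nonZero; ⌊_/2⌋; ⌈_/2⌉)
open import Data.Nat.DivMod using (_/_; m/n*n≤m; m*n/n≡m; /-monoˡ-≤)
open import Data.Nat.Logarithm using (⌊log₂_⌋; ⌊log₂⌋-mono-≤; ⌊log₂[2^n]⌋≡n)
open import Data.Nat.Properties
open import Data.Nat.Tactic.RingSolver using (solve-∀)
open import Data.Product using (Σ; _×_; _,_; proj₁; proj₂; ∃-syntax)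
open import Data.Product.Properties using (≡-dec)
open import Data.Sum using (_⊎_; inj₁; inj₂)
import Data.Sum as Sum
open import Data.Vec using (Vec; []; _∷_)
open import Function using (_∘_; id)
open import Relation.Binary.PropositionalEquality hiding ([_])
open import Relation.Nullary using (¬_; Dec; does; yes; no; contradiction; ¬?; _×-dec_; _⊎-dec_)
open import Relation.Nullary.Decidable using (⌊_⌋)
open import Relation.Unary using (Decidable)

private
  variable
    n k size : ℕ
    A B L : Set

-- Counting with filters and sublists.

length-filter-⊎ : {P Q R : A → Set} (P? : Decidable P) (Q? : Decidable Q) (R? : Decidable R) →
  (∀ x → R x → P x ⊎ Q x) → ∀ xs →
  length (filter R? xs) ≤ length (filter P? xs) + length (filter Q? xs)
length-filter-⊎ P? Q? R? R⇒P⊎Q [] = z≤n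
length-filter-⊎ P? Q? R? R⇒P⊎Q (x ∷ xs)
  with ih ← length-filter-⊎ P? Q? R? R⇒P⊎Q xs | R? x | P? x | Q? x
... | no _  | yes _ | yes _ = m≤n⇒m≤1+n (≤-trans ih (+-monoʳ-≤ _ (n≤1+n _)))
... | no _  | yes _ | no _  = m≤n⇒m≤1+n ih
... | no _  | no _  | yes _ = ≤-trans ih (+-monoʳ-≤ _ (n≤1+n _))
... | no _  | no _  | no _  = ih
... | yes _ | yes _ | yes _ = s≤s (≤-trans ih (+-monoʳ-≤ _ (n≤1+n _)))
... | yes _ | yes _ | no _  = s≤s ih
... | yes _ | no _  | yes _ = ≤-trans (s≤s ih) (≤-reflexive (sym (+-suc _ _)))
... | yes r | no ¬p | no ¬q with R⇒P⊎Q x r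
...   | inj₁ p = contradiction p ¬p
...   | inj₂ q = contradiction q ¬q

length-filter-∁ : {P : A → Set} (P? : Decidable P) → ∀ xs →
  length (filter (¬? ∘ P?) xs) + length (filter P? xs) ≡ length xs
length-filter-∁ P? [] = refl
length-filter-∁ P? (x ∷ xs) with ih ← length-filter-∁ P? xs | P? x
... | yes _ = trans (+-suc _ _) (cong suc ih)
... | no _  = cong suc ih

AllPairs-⊆ : {R : A → A → Set} {xs ys : List A} → xs ⊆ ys → AllPairs R ys → AllPairs R xs
AllPairs-⊆ []          []         = []
AllPairs-⊆ (_ ∷ʳ τ)    (_ ∷ rys)  = AllPairs-⊆ τ rys
AllPairs-⊆ (refl ∷ τ)  (ry ∷ rys) = Sublist.All-resp-⊆ τ ry ∷ AllPairs-⊆ τ rys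

Unique⇒lookup-injective : {xs : List A} → Unique xs → ∀ {i j} → lookup xs i ≡ lookup xs j → i ≡ j
Unique⇒lookup-injective (_ ∷ _)     {zero}  {zero}  _  = refl
Unique⇒lookup-injective (x≢ ∷ _)    {zero}  {suc j} eq = contradiction eq (All.lookup x≢ (∈-lookup j))
Unique⇒lookup-injective (x≢ ∷ _)    {suc i} {zero}  eq = contradiction (sym eq) (All.lookup x≢ (∈-lookup i))
Unique⇒lookup-injective (_ ∷ uniq)  {suc i} {suc j} eq = cong suc (Unique⇒lookup-injective uniq eq)

-- Matchings as lists of pairwise disjoint edges.

Disjoint : Edge n → Edge n → Set
Disjoint (a , b) (c , d) = a ≢ c × a ≢ d × b ≢ c × b ≢ d

disjoint? : (e f : Edge n) → Dec (Disjoint e f)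
disjoint? (a , b) (c , d) =
  ¬? (a Fin.≟ c) ×-dec ¬? (a Fin.≟ d) ×-dec ¬? (b Fin.≟ c) ×-dec ¬? (b Fin.≟ d)

Disjoint-sym : {e f : Edge n} → Disjoint e f → Disjoint f e
Disjoint-sym (p , q , r , s) = ≢-sym p , ≢-sym r , ≢-sym q , ≢-sym s

disjointE⁻ : (e f : Edge n) → disjointE e f ≡ true → Disjoint e f
disjointE⁻ (a , b) (c , d) eq with a Fin.≟ c | a Fin.≟ d | b Fin.≟ c | b Fin.≟ d
disjointE⁻ _ _ refl | no p | no q | no r | no s = p , q , r , s

disjointE⁺ : (e f : Edge n) → Disjoint e f → disjointE e f ≡ true
disjointE⁺ (a , b) (c , d) (p , q , r , s) with a Fin.≟ c | a Fin.≟ d | b Fin.≟ c | b Fin.≟ d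
... | yes p′ | _ | _ | _ = contradiction p′ p
... | no _ | yes q′ | _ | _ = contradiction q′ q
... | no _ | no _ | yes r′ | _ = contradiction r′ r
... | no _ | no _ | no _ | yes s′ = contradiction s′ s
... | no _ | no _ | no _ | no _ = refl

FreeOf : List (Edge n) → Edge n → Set
FreeOf M e = All (Disjoint e) M

freeOf? : (M : List (Edge n)) → Decidable (FreeOf M)
freeOf? M e = All.all? (disjoint? e) M

-- An edge is never `Disjoint` from itself, so this also forces the entries to be distinct.
Matching : List (Edge n) → Set
Matching = AllPairs Disjoint

∧-≡true : {x y : Bool} → x ∧ y ≡ true → x ≡ true × y ≡ true
∧-≡true {true} eq = refl , eq

disjointAll⁻ : (e : Edge n) (M : List (Edge n)) → disjointAll e M ≡ true → FreeOf M e
disjointAll⁻ e []      _  = []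
disjointAll⁻ e (f ∷ M) eq with ∧-≡true {disjointE e f} eq
... | p , q = disjointE⁻ e f p ∷ disjointAll⁻ e M q

disjointAll⁺ : (e : Edge n) (M : List (Edge n)) → FreeOf M e → disjointAll e M ≡ true
disjointAll⁺ e []      []       = refl
disjointAll⁺ e (f ∷ M) (p ∷ ps) = cong₂ _∧_ (disjointE⁺ e f p) (disjointAll⁺ e M ps)

isMatching⁻ : (M : List (Edge n)) → isMatching M ≡ true → Matching M
isMatching⁻ []      _  = []
isMatching⁻ (e ∷ M) eq with ∧-≡true {disjointAll e M} eq
... | p , q = disjointAll⁻ e M p ∷ isMatching⁻ M q

isMatching⁺ : (M : List (Edge n)) → Matching M → isMatching M ≡ true
isMatching⁺ []      []       = refl
isMatching⁺ (e ∷ M) (p ∷ ps) = cong₂ _∧_ (disjointAll⁺ e M p) (isMatching⁺ M ps)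

-- The first endpoints of the edges are pairwise distinct elements of `Fin n`.
Matching⇒length≤ : {M : List (Edge n)} → Matching M → length M ≤ n
Matching⇒length≤ {M = M} mM =
  subst (_≤ _) (length-map proj₁ M)
    (Fin.injective⇒≤ (Unique⇒lookup-injective (AllPairs.map⁺ (AllPairs.map proj₁ mM))))

∈-subsequences : {xs ys : List A} → xs ⊆ ys → xs ∈ subsequences ys
∈-subsequences []         = here refl
∈-subsequences {ys = y ∷ ys} (_ ∷ʳ τ)    = ∈-++⁺ˡ (∈-subsequences τ)
∈-subsequences {ys = y ∷ ys} (refl ∷ τ)  = ∈-++⁺ʳ (subsequences ys) (∈-map⁺ (y ∷_) (∈-subsequences τ))

≤-foldr-⊔ : {x : ℕ} {xs : List ℕ} → x ∈ xs → x ≤ foldr _⊔_ 0 xs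
≤-foldr-⊔ (here refl) = m≤m⊔n _ _
≤-foldr-⊔ (there x∈)  = ≤-trans (≤-foldr-⊔ x∈) (m≤n⊔m _ _)

⊆-Matching⇒length≤MM : {M H : List (Edge n)} → M ⊆ H → Matching M → length M ≤ MM H
⊆-Matching⇒length≤MM {M = M} M⊆H mM = ≤-foldr-⊔ (∈-map⁺ length
  (∈-filter⁺ (λ N → isMatching N Bool.≟ true) (∈-subsequences M⊆H) (isMatching⁺ M mM)))

Matching-↭ : {M N : List (Edge n)} → M ↭ N → Matching M → Matching N
Matching-↭ M↭N = ↭ₛ.AllPairs-resp-↭ (setoid _) Disjoint-sym ((λ { refl → id }) , λ { refl → id }) (↭⇒↭ₛ M↭N)

open module EdgeMembership {n} = DecMembership (≡-dec (Fin._≟_ {n}) (Fin._≟_ {n})) using (_∈?_)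

∈-tail : {x y : A} {xs : List A} → x ≢ y → x ∈ y ∷ xs → x ∈ xs
∈-tail x≢y (here x≡y) = contradiction x≡y x≢y
∈-tail x≢y (there x∈) = x∈

-- Reorders a matching into a sublist; disjointness makes each edge occur once.
Matching-∈⇒⊆ : (H : List (Edge n)) {M : List (Edge n)} → Matching M → All (_∈ H) M →
  ∃[ N ] N ⊆ H × M ↭ N
Matching-∈⇒⊆ []      {[]}    mM []       = [] , [] , ↭-refl
Matching-∈⇒⊆ []      {_ ∷ _} mM (() ∷ _)
Matching-∈⇒⊆ (h ∷ H) {M} mM M∈ with h ∈? M
... | no h∉M with Matching-∈⇒⊆ H mM (All.tabulate (λ e∈M → ∈-tail (λ { refl → h∉M e∈M }) (All.lookup M∈ e∈M)))
...   | N , N⊆H , M↭N = N , h ∷ʳ N⊆H , M↭N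
Matching-∈⇒⊆ (h ∷ H) {M} mM M∈ | yes h∈M with ∈-∃++ h∈M
... | ys , zs , refl with Matching-↭ (shift h ys zs) mM | All-resp-↭ (shift h ys zs) M∈
...   | h# ∷ mM′ | _ ∷ M′∈
  with Matching-∈⇒⊆ H mM′ (All.zipWith (λ { (d , e∈) → ∈-tail (λ { refl → proj₁ d refl }) e∈ }) (h# , M′∈))
...     | N , N⊆H , M′↭N = h ∷ N , refl ∷ N⊆H , ↭-trans (shift h ys zs) (prep h M′↭N)

-- The matchings measured against `MM` are assembled by concatenation and need not follow the order
-- of `H`, so membership takes the place of `⊆`.
Matching⇒length≤MM : {M H : List (Edge n)} → Matching M → All (_∈ H) M → length M ≤ MM H
Matching⇒length≤MM {H = H} mM M∈ with Matching-∈⇒⊆ H mM M∈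
... | N , N⊆H , M↭N =
  ≤-trans (≤-reflexive (↭-length M↭N)) (⊆-Matching⇒length≤MM N⊆H (Matching-↭ M↭N mM))

-- Each edge is charged to one host that contains it, and both classes are again matchings.
Matching⇒length≤MM+MM : {H K : List (Edge n)} (M : List (Edge n)) → Matching M →
  All (λ e → e ∈ H ⊎ e ∈ K) M → length M ≤ MM H + MM K
Matching⇒length≤MM+MM {n} {H} {K} M mM M∈ =
  let P , Q , P⊆M , Q⊆M , P∈ , Q∈ , eq = split M M∈ in
  ≤-trans (≤-reflexive eq)
    (+-mono-≤ (Matching⇒length≤MM (AllPairs-⊆ P⊆M mM) P∈) (Matching⇒length≤MM (AllPairs-⊆ Q⊆M mM) Q∈))
  where
  split : (M : List (Edge n)) → All (λ e → e ∈ H ⊎ e ∈ K) M →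
    ∃[ P ] ∃[ Q ] P ⊆ M × Q ⊆ M × All (_∈ H) P × All (_∈ K) Q × length M ≡ length P + length Q
  split []      []            = [] , [] , [] , [] , [] , [] , refl
  split (e ∷ M) (inj₁ p ∷ ps) = let P , Q , P⊆ , Q⊆ , P∈ , Q∈ , eq = split M ps in
    e ∷ P , Q , refl ∷ P⊆ , e ∷ʳ Q⊆ , p ∷ P∈ , Q∈ , cong suc eq
  split (e ∷ M) (inj₂ q ∷ ps) = let P , Q , P⊆ , Q⊆ , P∈ , Q∈ , eq = split M ps in
    P , e ∷ Q , e ∷ʳ P⊆ , refl ∷ Q⊆ , P∈ , q ∷ Q∈ , trans (cong suc eq) (sym (+-suc _ _))

Meets : Fin n → Edge n → Set
Meets v (a , b) = a ≡ v ⊎ b ≡ v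

meets? : (v : Fin n) → Decidable (Meets v)
meets? v (a , b) = (a Fin.≟ v) ⊎-dec (b Fin.≟ v)

¬Disjoint⇒Meets : (e : Edge n) {a b : Fin n} → ¬ Disjoint e (a , b) → Meets a e ⊎ Meets b e
¬Disjoint⇒Meets (c , d) {a} {b} ¬d with c Fin.≟ a | c Fin.≟ b | d Fin.≟ a | d Fin.≟ b
... | yes p | _     | _     | _     = inj₁ (inj₁ p)
... | no _  | yes q | _     | _     = inj₂ (inj₁ q)
... | no _  | no _  | yes r | _     = inj₁ (inj₂ r)
... | no _  | no _  | no _  | yes s = inj₂ (inj₂ s)
... | no p  | no q  | no r  | no s  = contradiction (p , q , r , s) ¬d

Meets⇒¬Disjoint : {v : Fin n} {e f : Edge n} → Meets v e → Meets v f → ¬ Disjoint e f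
Meets⇒¬Disjoint (inj₁ refl) (inj₁ refl) (p , _)         = p refl
Meets⇒¬Disjoint (inj₁ refl) (inj₂ refl) (_ , q , _)     = q refl
Meets⇒¬Disjoint (inj₂ refl) (inj₁ refl) (_ , _ , r , _) = r refl
Meets⇒¬Disjoint (inj₂ refl) (inj₂ refl) (_ , _ , _ , s) = s refl

length-filter-meets : (v : Fin n) {M : List (Edge n)} → Matching M → length (filter (meets? v) M) ≤ 1
length-filter-meets v []        = z≤n
length-filter-meets v {e ∷ M} (e# ∷ mM) with meets? v e
... | no ¬ve = ≤-trans (≤-reflexive (cong length (filter-reject (meets? v) ¬ve))) (length-filter-meets v mM)
... | yes ve = ≤-reflexive (cong length (trans (filter-accept (meets? v) ve)
      (cong (e ∷_) (filter-none (meets? v) (All.map (λ d vf → Meets⇒¬Disjoint ve vf d) e#)))))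

-- Each edge of `N` has two endpoints, and by `length-filter-meets` each endpoint lies on at most
-- one edge of `M`.
length-filter-¬freeOf : {M : List (Edge n)} → Matching M → (N : List (Edge n)) →
  length (filter (¬? ∘ freeOf? N) M) ≤ 2 * length N
length-filter-¬freeOf {M = M} mM [] =
  ≤-reflexive (cong length (filter-none (¬? ∘ freeOf? []) {M} (All.tabulate (λ _ ¬free → ¬free []))))
length-filter-¬freeOf {M = M} mM (f@(a , b) ∷ N) = begin
  length (filter (¬? ∘ freeOf? (f ∷ N)) M)
    ≤⟨ length-filter-⊎ (¬? ∘ λ e → disjoint? e f) (¬? ∘ freeOf? N) (¬? ∘ freeOf? (f ∷ N)) split M ⟩
  length (filter (¬? ∘ λ e → disjoint? e f) M) + length (filter (¬? ∘ freeOf? N) M)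
    ≤⟨ +-mono-≤ (length-filter-⊎ (meets? a) (meets? b) (¬? ∘ λ e → disjoint? e f) (λ e → ¬Disjoint⇒Meets e) M)
                (length-filter-¬freeOf mM N) ⟩
  (length (filter (meets? a) M) + length (filter (meets? b) M)) + 2 * length N
    ≤⟨ +-monoˡ-≤ _ (+-mono-≤ (length-filter-meets a mM) (length-filter-meets b mM)) ⟩
  2 + 2 * length N
    ≡⟨ *-suc 2 (length N) ⟨
  2 * suc (length N) ∎
  where
  open ≤-Reasoning
  split : ∀ e → ¬ FreeOf (f ∷ N) e → ¬ Disjoint e f ⊎ ¬ FreeOf N e
  split e ¬free with disjoint? e f
  ... | no ¬d = inj₁ ¬d
  ... | yes d = inj₂ (λ free → ¬free (d ∷ free))

-- Finite sums, indicators and the number of assignments.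

∑ : List A → (A → ℕ) → ℕ
∑ []       f = 0
∑ (x ∷ xs) f = f x + ∑ xs f

∑-cong : (xs : List A) {f g : A → ℕ} → (∀ x → f x ≡ g x) → ∑ xs f ≡ ∑ xs g
∑-cong []       f≡g = refl
∑-cong (x ∷ xs) f≡g = cong₂ _+_ (f≡g x) (∑-cong xs f≡g)

∑-mono : (xs : List A) {f g : A → ℕ} → (∀ {x} → x ∈ xs → f x ≤ g x) → ∑ xs f ≤ ∑ xs g
∑-mono []       f≤g = z≤n
∑-mono (x ∷ xs) f≤g = +-mono-≤ (f≤g (here refl)) (∑-mono xs (f≤g ∘ there))

∑-const : (xs : List A) (c : ℕ) → ∑ xs (λ _ → c) ≡ length xs * c
∑-const []       c = refl
∑-const (x ∷ xs) c = cong (c +_) (∑-const xs c)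

∑-zero : (xs : List A) → ∑ xs (λ _ → 0) ≡ 0
∑-zero xs = trans (∑-const xs 0) (*-zeroʳ (length xs))

∑-+ : (xs : List A) (f g : A → ℕ) → ∑ xs (λ x → f x + g x) ≡ ∑ xs f + ∑ xs g
∑-+ []       f g = refl
∑-+ (x ∷ xs) f g rewrite ∑-+ xs f g = arith (f x) (g x) (∑ xs f) (∑ xs g)
  where
  arith : ∀ a b c d → a + b + (c + d) ≡ a + c + (b + d)
  arith = solve-∀

∑-*ʳ : (xs : List A) (f : A → ℕ) (c : ℕ) → ∑ xs f * c ≡ ∑ xs (λ x → f x * c)
∑-*ʳ []       f c = refl
∑-*ʳ (x ∷ xs) f c = trans (*-distribʳ-+ c (f x) (∑ xs f)) (cong (f x * c +_) (∑-*ʳ xs f c))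

∑-++ : (xs ys : List A) (f : A → ℕ) → ∑ (xs ++ ys) f ≡ ∑ xs f + ∑ ys f
∑-++ []       ys f = refl
∑-++ (x ∷ xs) ys f = trans (cong (f x +_) (∑-++ xs ys f)) (sym (+-assoc (f x) _ _))

∑-map : (g : A → B) (xs : List A) (f : B → ℕ) → ∑ (map g xs) f ≡ ∑ xs (f ∘ g)
∑-map g []       f = refl
∑-map g (x ∷ xs) f = cong (f (g x) +_) (∑-map g xs f)

∑-concatMap : (g : A → List B) (xs : List A) (f : B → ℕ) →
  ∑ (concatMap g xs) f ≡ ∑ xs (λ x → ∑ (g x) f)
∑-concatMap g []       f = refl
∑-concatMap g (x ∷ xs) f =
  trans (∑-++ (g x) (concatMap g xs) f) (cong (∑ (g x) f +_) (∑-concatMap g xs f))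

∑-swap : (xs : List A) (ys : List B) (f : A → B → ℕ) →
  ∑ xs (λ x → ∑ ys (f x)) ≡ ∑ ys (λ y → ∑ xs (λ x → f x y))
∑-swap []       ys f = sym (∑-zero ys)
∑-swap (x ∷ xs) ys f =
  trans (cong (∑ ys (f x) +_) (∑-swap xs ys f)) (sym (∑-+ ys (f x) (λ y → ∑ xs (λ x → f x y))))

indicator : {P : A → Set} → Decidable P → A → ℕ
indicator P? x = if does (P? x) then 1 else 0

indicator-≤1 : {P : A → Set} (P? : Decidable P) (x : A) → indicator P? x ≤ 1
indicator-≤1 P? x with P? x
... | yes _ = s≤s z≤n
... | no _  = z≤n

indicator-¬ : {P : A → Set} (P? : Decidable P) {x : A} → ¬ P x → indicator P? x ≡ 0
indicator-¬ P? {x} ¬p with P? x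
... | yes p = contradiction p ¬p
... | no _  = refl

length-filter≡∑ : {P : A → Set} (P? : Decidable P) (xs : List A) →
  length (filter P? xs) ≡ ∑ xs (indicator P?)
length-filter≡∑ P? [] = refl
length-filter≡∑ P? (x ∷ xs) with ih ← length-filter≡∑ P? xs | P? x
... | yes _ = cong suc ih
... | no _  = ih

∑-assignments : (k m : ℕ) (f : Vec (Fin k) (suc m) → ℕ) →
  ∑ (assignments k (suc m)) f ≡ ∑ (allFin k) (λ i → ∑ (assignments k m) (λ p → f (i ∷ p)))
∑-assignments k m f = trans (∑-concatMap _ (allFin k) f)
  (∑-cong (allFin k) (λ i → ∑-map (i ∷_) (assignments k m) f))

length-assignments : (k m : ℕ) → length (assignments k m) ≡ k ^ m
length-assignments k zero    = refl
length-assignments k (suc m) = begin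
  length (assignments k (suc m))                    ≡⟨ *-identityʳ _ ⟨
  length (assignments k (suc m)) * 1                ≡⟨ ∑-const (assignments k (suc m)) 1 ⟨
  ∑ (assignments k (suc m)) (λ _ → 1)               ≡⟨ ∑-assignments k m (λ _ → 1) ⟩
  ∑ (allFin k) (λ _ → ∑ (assignments k m) (λ _ → 1)) ≡⟨ ∑-const (allFin k) _ ⟩
  length (allFin k) * ∑ (assignments k m) (λ _ → 1) ≡⟨ cong₂ _*_ (length-tabulate {n = k} id)
                                                        (trans (∑-const (assignments k m) 1) (*-identityʳ _)) ⟩
  k * length (assignments k m)                      ≡⟨ cong (k *_) (length-assignments k m) ⟩
  k * k ^ m                                         ∎
  where open ≡-Reasoning

-- Partially revealed labellings.

-- A partially revealed labelling: at nothing, the label is still to be drawn from a given list.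
Partial : Set → ℕ → Set
Partial L = Vec (Maybe L)

-- Sums over drawn labels are pushed into the summand, so the recursion is structural and no list of
-- completions is built.
∑-completions : List L → Partial L size → (Vec L size → ℕ) → ℕ
∑-completions ls []            f = f []
∑-completions ls (just a ∷ x)  f = ∑-completions ls x (λ p → f (a ∷ p))
∑-completions ls (nothing ∷ x) f = ∑-completions ls x (λ p → ∑ ls (λ a → f (a ∷ p)))

-- The range of summation of `∑-completions`: two summands have to be compared on these labellings
-- only.
data Completion (ls : List L) : Partial L size → Vec L size → Set where
  []    : Completion ls [] []
  fixed : ∀ {a} {x : Partial L size} {p} → Completion ls x p → Completion ls (just a ∷ x) (a ∷ p)
  drawn : ∀ {a} {x : Partial L size} {p} → a ∈ ls → Completion ls x p → Completion ls (nothing ∷ x) (a ∷ p)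

∑-completions-mono : (ls : List L) (x : Partial L size) {f g : Vec L size → ℕ} →
  (∀ p → Completion ls x p → f p ≤ g p) → ∑-completions ls x f ≤ ∑-completions ls x g
∑-completions-mono ls []            f≤g = f≤g [] []
∑-completions-mono ls (just a ∷ x)  f≤g = ∑-completions-mono ls x (λ p c → f≤g _ (fixed c))
∑-completions-mono ls (nothing ∷ x) f≤g =
  ∑-completions-mono ls x (λ p c → ∑-mono ls (λ a∈ → f≤g _ (drawn a∈ c)))

∑-completions-cong : (ls : List L) (x : Partial L size) {f g : Vec L size → ℕ} →
  (∀ p → f p ≡ g p) → ∑-completions ls x f ≡ ∑-completions ls x g
∑-completions-cong ls x f≡g = ≤-antisym
  (∑-completions-mono ls x (λ p _ → ≤-reflexive (f≡g p)))
  (∑-completions-mono ls x (λ p _ → ≤-reflexive (sym (f≡g p))))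

∑-completions-+ : (ls : List L) (x : Partial L size) (f g : Vec L size → ℕ) →
  ∑-completions ls x (λ p → f p + g p) ≡ ∑-completions ls x f + ∑-completions ls x g
∑-completions-+ ls []            f g = refl
∑-completions-+ ls (just a ∷ x)  f g = ∑-completions-+ ls x _ _
∑-completions-+ ls (nothing ∷ x) f g =
  trans (∑-completions-cong ls x (λ p → ∑-+ ls _ _)) (∑-completions-+ ls x _ _)

unrevealed : (E : List A) → Partial L (length E) → List A
unrevealed []      []            = []
unrevealed (e ∷ E) (just _ ∷ x)  = unrevealed E x
unrevealed (e ∷ E) (nothing ∷ x) = e ∷ unrevealed E x

∑-completions-const : (ls : List L) (E : List A) (x : Partial L (length E)) (c : ℕ) →
  ∑-completions ls x (λ _ → c) ≡ c * length ls ^ length (unrevealed E x)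
∑-completions-const ls []      []            c = sym (*-identityʳ c)
∑-completions-const ls (e ∷ E) (just a ∷ x)  c = ∑-completions-const ls E x c
∑-completions-const ls (e ∷ E) (nothing ∷ x) c = begin
  ∑-completions ls x (λ _ → ∑ ls (λ _ → c)) ≡⟨ ∑-completions-const ls E x _ ⟩
  ∑ ls (λ _ → c) * l ^ o                    ≡⟨ cong (_* l ^ o) (trans (∑-const ls c) (*-comm l c)) ⟩
  c * l * l ^ o                             ≡⟨ *-assoc c l _ ⟩
  c * (l * l ^ o)                           ∎
  where
  open ≡-Reasoning
  l = length ls
  o = length (unrevealed E x)

∑-revelations : L → Partial L size → (Partial L size → ℕ) → ℕ
∑-revelations i []            g = g []
∑-revelations i (just a ∷ x)  g = ∑-revelations i x (λ y → g (just a ∷ y))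
∑-revelations i (nothing ∷ x) g =
  ∑-revelations i x (λ y → g (just i ∷ y)) + ∑-revelations i x (λ y → g (nothing ∷ y))

-- A draw from `i ∷ ls` first decides which unrevealed entries get `i` and then completes the others
-- from `ls`. Repeating this reveals the labels one at a time.
∑-completions-∷ : (i : L) (ls : List L) (x : Partial L size) (f : Vec L size → ℕ) →
  ∑-completions (i ∷ ls) x f ≡ ∑-revelations i x (λ y → ∑-completions ls y f)
∑-completions-∷ i ls []            f = refl
∑-completions-∷ i ls (just a ∷ x)  f = ∑-completions-∷ i ls x _
∑-completions-∷ i ls (nothing ∷ x) f =
  trans (∑-completions-+ (i ∷ ls) x _ _)
    (cong₂ _+_ (∑-completions-∷ i ls x _) (∑-completions-∷ i ls x _))

-- Revelation i E x y S R: y reveals which unrevealed items of x carry label i;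
-- these form S, the others form R.
data Revelation {A L : Set} (i : L) : (E : List A) (x y : Partial L (length E)) (S R : List A) → Set where
  []    : Revelation i [] [] [] [] []
  old   : ∀ {e E x y S R a} → Revelation i E x y S R → Revelation i (e ∷ E) (just a ∷ x) (just a ∷ y) S R
  now   : ∀ {e E x y S R} → Revelation i E x y S R → Revelation i (e ∷ E) (nothing ∷ x) (just i ∷ y) (e ∷ S) R
  later : ∀ {e E x y S R} → Revelation i E x y S R → Revelation i (e ∷ E) (nothing ∷ x) (nothing ∷ y) S (e ∷ R)

-- The binomial theorem over the choices of `S`: an item satisfying `P` contributes `a` if taken and
-- `b` if left, any other item `1` or `b`, and the sum over all choices is the product. The factor
-- `c` clears the denominators of the intended estimate.
∑-revelations-bound : {P : A → Set} (P? : Decidable P) (i : L) (a b c K : ℕ) (E : List A)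
  (x : Partial L (length E)) (g : Partial L (length E) → ℕ) →
  (∀ {y S R} → Revelation i E x y S R → g y * c ≤ K * (a ^ length (filter P? S) * b ^ length R)) →
  ∑-revelations i x g * c ≤
    K * ((a + b) ^ length (filter P? (unrevealed E x)) * (1 + b) ^ length (filter (¬? ∘ P?) (unrevealed E x)))
∑-revelations-bound P? i a b c K []      []            g h = h []
∑-revelations-bound P? i a b c K (e ∷ E) (just _ ∷ x)  g h =
  ∑-revelations-bound P? i a b c K E x _ (h ∘ old)
∑-revelations-bound P? i a b c K (e ∷ E) (nothing ∷ x) g h = begin
  (∑-revelations i x (λ y → g (just i ∷ y)) + ∑-revelations i x (λ y → g (nothing ∷ y))) * c
    ≡⟨ *-distribʳ-+ c (∑-revelations i x (λ y → g (just i ∷ y))) _ ⟩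
  ∑-revelations i x (λ y → g (just i ∷ y)) * c + ∑-revelations i x (λ y → g (nothing ∷ y)) * c
    ≤⟨ +-mono-≤ (∑-revelations-bound P? i a b c (K * w) E x _ taken)
                (∑-revelations-bound P? i a b c (K * b) E x _ skipped) ⟩
  K * w * W + K * b * W
    ≡⟨ combine ⟩
  K * ((a + b) ^ length (filter P? (e ∷ U)) * (1 + b) ^ length (filter (¬? ∘ P?) (e ∷ U))) ∎
  where
  open ≤-Reasoning
  U = unrevealed E x
  W = (a + b) ^ length (filter P? U) * (1 + b) ^ length (filter (¬? ∘ P?) U)
  -- This is `a` or `1` according to `P? e`; one expression serves both outcomes until `combine`.
  w = a ^ length (filter P? (e ∷ []))
  filter-length : ∀ S → length (filter P? (e ∷ S)) ≡ length (filter P? (e ∷ [])) + length (filter P? S)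
  filter-length S with P? e
  ... | yes _ = refl
  ... | no _  = refl
  taken : ∀ {y S R} → Revelation i E x y S R →
    g (just i ∷ y) * c ≤ K * w * (a ^ length (filter P? S) * b ^ length R)
  taken {y} {S} {R} r = ≤-trans (h (now r)) (≤-reflexive
    (trans (cong (λ l → K * (a ^ l * b ^ length R)) (filter-length S))
    (trans (cong (λ z → K * (z * b ^ length R)) (^-distribˡ-+-* a (length (filter P? (e ∷ []))) (length (filter P? S))))
      (arith K w (a ^ length (filter P? S)) (b ^ length R)))))
    where
    arith : ∀ K w s r → K * (w * s * r) ≡ K * w * (s * r)
    arith = solve-∀
  skipped : ∀ {y S R} → Revelation i E x y S R →
    g (nothing ∷ y) * c ≤ K * b * (a ^ length (filter P? S) * b ^ length R)
  skipped {y} {S} {R} r = ≤-trans (h (later r))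
    (≤-reflexive (arith K b (a ^ length (filter P? S)) (b ^ length R)))
    where
    arith : ∀ K b s r → K * (s * (b * r)) ≡ K * b * (s * r)
    arith = solve-∀
  combine : K * w * W + K * b * W ≡
    K * ((a + b) ^ length (filter P? (e ∷ U)) * (1 + b) ^ length (filter (¬? ∘ P?) (e ∷ U)))
  combine with P? e
  ... | yes _ = arith K a b ((a + b) ^ length (filter P? U)) ((1 + b) ^ length (filter (¬? ∘ P?) U))
    where
    arith : ∀ K a b s t → K * (a * 1) * (s * t) + K * b * (s * t) ≡ K * ((a + b) * s * t)
    arith = solve-∀
  ... | no _  = arith K b ((a + b) ^ length (filter P? U)) ((1 + b) ^ length (filter (¬? ∘ P?) U))
    where
    arith : ∀ K b s t → K * 1 * (s * t) + K * b * (s * t) ≡ K * (s * ((1 + b) * t))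
    arith = solve-∀

module _ {i : L} where

  Revelation-unrevealed : ∀ {E : List A} {x y S R} → Revelation i E x y S R → unrevealed E y ≡ R
  Revelation-unrevealed []       = refl
  Revelation-unrevealed (old r) = Revelation-unrevealed r
  Revelation-unrevealed (now r) = Revelation-unrevealed r
  Revelation-unrevealed (later r) = cong (_ ∷_) (Revelation-unrevealed r)

  Revelation-⊆ˡ : ∀ {E : List A} {x y S R} → Revelation i E x y S R → S ⊆ unrevealed E x
  Revelation-⊆ˡ []       = []
  Revelation-⊆ˡ (old r) = Revelation-⊆ˡ r
  Revelation-⊆ˡ (now r) = refl ∷ Revelation-⊆ˡ r
  Revelation-⊆ˡ (later r) = _ ∷ʳ Revelation-⊆ˡ r

  Revelation-⊆ʳ : ∀ {E : List A} {x y S R} → Revelation i E x y S R → R ⊆ unrevealed E x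
  Revelation-⊆ʳ []       = []
  Revelation-⊆ʳ (old r) = Revelation-⊆ʳ r
  Revelation-⊆ʳ (now r) = _ ∷ʳ Revelation-⊆ʳ r
  Revelation-⊆ʳ (later r) = refl ∷ Revelation-⊆ʳ r

  Revelation-length : ∀ {E : List A} {x y S R} → Revelation i E x y S R →
    length S + length R ≡ length (unrevealed E x)
  Revelation-length []       = refl
  Revelation-length (old r) = Revelation-length r
  Revelation-length (now r) = cong suc (Revelation-length r)
  Revelation-length (later r) = trans (+-suc _ _) (cong suc (Revelation-length r))

  Revelation-Completion : ∀ {E : List A} {x y S R ls p} → Revelation i E x y S R →
    Completion ls y p → Completion (i ∷ ls) x p
  Revelation-Completion []       []           = []
  Revelation-Completion (old r) (fixed c)    = fixed (Revelation-Completion r c)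
  Revelation-Completion (now r) (fixed c)    = drawn (here refl) (Revelation-Completion r c)
  Revelation-Completion (later r) (drawn a∈ c) = drawn (there a∈) (Revelation-Completion r c)

-- The parts of the edge set under a partial labelling.

knownPart : (E : List (Edge n)) → Partial (Fin k) (length E) → Fin k → List (Edge n)
knownPart []      []            i = []
knownPart (e ∷ E) (just j ∷ x)  i = if ⌊ j Fin.≟ i ⌋ then e ∷ knownPart E x i else knownPart E x i
knownPart (e ∷ E) (nothing ∷ x) i = knownPart E x i

-- Entries still to be drawn come from `ls` and never receive `i`. Part `i` is therefore final, and
-- `ALG` can be evaluated on it while other labels stay open.
part≡knownPart : {i : Fin k} {ls : List (Fin k)} → i ∉ ls → (E : List (Edge n))
  {x : Partial (Fin k) (length E)} {p : Vec (Fin k) (length E)} →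
  Completion ls x p → part E p i ≡ knownPart E x i
part≡knownPart i∉ []      []        = refl
part≡knownPart {i = i} i∉ (e ∷ E) (fixed {a = j} c) with j Fin.≟ i
... | yes _ = cong (e ∷_) (part≡knownPart i∉ E c)
... | no _  = part≡knownPart i∉ E c
part≡knownPart {i = i} i∉ (e ∷ E) (drawn {a = j} a∈ c) with j Fin.≟ i
... | yes refl = contradiction a∈ i∉
... | no _     = part≡knownPart i∉ E c

module _ {i : Fin k} where

  -- Together with the two inclusions below, this says that revealing label `i` adds to its part the
  -- edges of `S` and nothing else.
  knownPart-Revelation : ∀ {E : List (Edge n)} {x y S R} → Revelation i E x y S R →
    ∀ {e} → e ∈ knownPart E y i → e ∈ knownPart E x i ⊎ e ∈ S
  knownPart-Revelation (old {a = j} r) e∈ with j Fin.≟ i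
  knownPart-Revelation (old r) (here refl) | yes _ = inj₁ (here refl)
  knownPart-Revelation (old r) (there e∈)  | yes _ = Sum.map₁ there (knownPart-Revelation r e∈)
  knownPart-Revelation (old r) e∈          | no _  = knownPart-Revelation r e∈
  knownPart-Revelation (now r) e∈ with i Fin.≟ i
  knownPart-Revelation (now r) (here refl) | yes _ = inj₂ (here refl)
  knownPart-Revelation (now r) (there e∈)  | yes _ = Sum.map₂ there (knownPart-Revelation r e∈)
  knownPart-Revelation (now r) e∈          | no i≢i = contradiction refl i≢i
  knownPart-Revelation (later r) e∈ = knownPart-Revelation r e∈

  Revelation-knownPartˡ : ∀ {E : List (Edge n)} {x y S R} → Revelation i E x y S R →
    ∀ {e} → e ∈ knownPart E x i → e ∈ knownPart E y i
  Revelation-knownPartˡ (old {a = j} r) e∈ with j Fin.≟ i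
  Revelation-knownPartˡ (old r) (here refl) | yes _ = here refl
  Revelation-knownPartˡ (old r) (there e∈)  | yes _ = there (Revelation-knownPartˡ r e∈)
  Revelation-knownPartˡ (old r) e∈          | no _  = Revelation-knownPartˡ r e∈
  Revelation-knownPartˡ (now r) e∈ with i Fin.≟ i
  ... | yes _  = there (Revelation-knownPartˡ r e∈)
  ... | no i≢i = contradiction refl i≢i
  Revelation-knownPartˡ (later r) e∈ = Revelation-knownPartˡ r e∈

  Revelation-knownPartʳ : ∀ {E : List (Edge n)} {x y S R} → Revelation i E x y S R →
    ∀ {e} → e ∈ S → e ∈ knownPart E y i
  Revelation-knownPartʳ (old {a = j} r) e∈ with j Fin.≟ i
  ... | yes _ = there (Revelation-knownPartʳ r e∈)
  ... | no _  = Revelation-knownPartʳ r e∈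
  Revelation-knownPartʳ (now r) e∈ with i Fin.≟ i
  Revelation-knownPartʳ (now r) (here refl) | yes _ = here refl
  Revelation-knownPartʳ (now r) (there e∈)  | yes _ = there (Revelation-knownPartʳ r e∈)
  Revelation-knownPartʳ (now r) e∈          | no i≢i = contradiction refl i≢i
  Revelation-knownPartʳ (later r) e∈ = Revelation-knownPartʳ r e∈

-- Conditioning on the labels outside a matching.

-- Fixing the labels outside M reduces a bound on all labellings to bounds on those of M.
∑-assignments-bound : {M E : List A} → M ⊆ E → (f : Vec (Fin k) (length E) → ℕ) (c B : ℕ) →
  (∀ x → unrevealed E x ≡ M → ∑-completions (allFin k) x f * c ≤ B) →
  ∑ (assignments k (length E)) f * c * k ^ length M ≤ k ^ length E * B
∑-assignments-bound [] f c B h = begin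
  (f [] + 0) * c * 1 ≡⟨ *-identityʳ _ ⟩
  (f [] + 0) * c     ≡⟨ cong (_* c) (+-identityʳ (f [])) ⟩
  f [] * c           ≤⟨ h [] refl ⟩
  B                  ≡⟨ *-identityˡ B ⟨
  1 * B              ∎
  where open ≤-Reasoning
∑-assignments-bound {k = k} {M = M} {E = e ∷ E} (.e ∷ʳ τ) f c B h = begin
  ∑ (assignments k (suc (length E))) f * c * k ^ length M
    ≡⟨ cong (λ z → z * c * k ^ length M) (∑-assignments k (length E) f) ⟩
  ∑ (allFin k) (λ i → ∑ (assignments k (length E)) (λ p → f (i ∷ p))) * c * k ^ length M
    ≡⟨ *-assoc (∑ (allFin k) _) c _ ⟩
  ∑ (allFin k) (λ i → ∑ (assignments k (length E)) (λ p → f (i ∷ p))) * (c * k ^ length M)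
    ≡⟨ ∑-*ʳ (allFin k) _ _ ⟩
  ∑ (allFin k) (λ i → ∑ (assignments k (length E)) (λ p → f (i ∷ p)) * (c * k ^ length M))
    ≤⟨ ∑-mono (allFin k) (λ {i} _ → ≤-trans (≤-reflexive (sym (*-assoc (∑ (assignments k (length E)) _) c _)))
         (∑-assignments-bound τ (λ p → f (i ∷ p)) c B (λ x → h (just i ∷ x)))) ⟩
  ∑ (allFin k) (λ _ → k ^ length E * B)
    ≡⟨ ∑-const (allFin k) _ ⟩
  length (allFin k) * (k ^ length E * B)
    ≡⟨ cong (_* (k ^ length E * B)) (length-tabulate {n = k} id) ⟩
  k * (k ^ length E * B)
    ≡⟨ *-assoc k _ B ⟨
  k ^ suc (length E) * B ∎
  where open ≤-Reasoning
∑-assignments-bound {k = k} {M = e ∷ M} {E = .e ∷ E} (refl ∷ τ) f c B h = begin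
  ∑ (assignments k (suc (length E))) f * c * (k * k ^ length M)
    -- The label of an edge of `M` is moved innermost, where `∑-completions` sums it at `nothing`.
    ≡⟨ cong (λ z → z * c * (k * k ^ length M)) (trans (∑-assignments k (length E) f)
         (∑-swap (allFin k) (assignments k (length E)) (λ i p → f (i ∷ p)))) ⟩
  F * c * (k * k ^ length M)
    ≡⟨ arith F c k (k ^ length M) ⟩
  k * (F * c * k ^ length M)
    ≤⟨ *-monoʳ-≤ k (∑-assignments-bound τ (λ p → ∑ (allFin k) (λ i → f (i ∷ p))) c B
         (λ x eq → h (nothing ∷ x) (cong (e ∷_) eq))) ⟩
  k * (k ^ length E * B)
    ≡⟨ *-assoc k _ B ⟨
  k ^ suc (length E) * B ∎
  where
  open ≤-Reasoning
  F = ∑ (assignments k (length E)) (λ p → ∑ (allFin k) (λ i → f (i ∷ p)))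
  arith : ∀ F c k m → F * c * (k * m) ≡ k * (F * c * m)
  arith = solve-∀

-- The cubic weight that pays for conflicting edges.

-- A rising factorial of length three, into which the ratios `(4 + b) / (1 + b)` of successive steps
-- telescope.
rising₃ : ℕ → ℕ
rising₃ b = (1 + b) * (2 + b) * (3 + b)

rising₃-suc : ∀ b → rising₃ b * (4 + b) ≡ rising₃ (suc b) * (1 + b)
rising₃-suc b = arith b
  where
  arith : ∀ b → (1 + b) * (2 + b) * (3 + b) * (4 + b) ≡ (2 + b) * (3 + b) * (4 + b) * (1 + b)
  arith = solve-∀

rising₃-≤-suc : ∀ b → rising₃ b ≤ rising₃ (suc b)
rising₃-≤-suc b = *-mono-≤ (*-mono-≤ (n≤1+n (1 + b)) (n≤1+n (2 + b))) (n≤1+n (3 + b))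

^-distribʳ-* : ∀ m n o → (m * n) ^ o ≡ m ^ o * n ^ o
^-distribʳ-* m n zero    = refl
^-distribʳ-* m n (suc o) rewrite ^-distribʳ-* m n o = arith m n (m ^ o) (n ^ o)
  where
  arith : ∀ m n x y → m * n * (x * y) ≡ m * x * (n * y)
  arith = solve-∀

-- By `rising₃-suc`, each of the `F` factors `4 + b` becomes `1 + b` when one factor `rising₃ b` is
-- raised to `rising₃ (suc b)`. The other `t - F` factors only grow.
rising₃-step : ∀ b {t u F U} → F ≤ t → F + U ≡ u →
  rising₃ b ^ t * ((4 + b) ^ F * (1 + b) ^ U) ≤ rising₃ (suc b) ^ t * (1 + b) ^ u
rising₃-step b {t} {u} {F} {U} F≤t refl with m≤n⇒∃[o]m+o≡n F≤t
... | δ , refl = begin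
  D ^ (F + δ) * (X ^ F * Y ^ U)        ≡⟨ cong (_* (X ^ F * Y ^ U)) (^-distribˡ-+-* D F δ) ⟩
  D ^ F * D ^ δ * (X ^ F * Y ^ U)      ≡⟨ arith (D ^ F) (D ^ δ) (X ^ F) (Y ^ U) ⟩
  D ^ F * X ^ F * (D ^ δ * Y ^ U)      ≡⟨ cong (_* (D ^ δ * Y ^ U)) (^-distribʳ-* D X F) ⟨
  (D * X) ^ F * (D ^ δ * Y ^ U)        ≡⟨ cong (λ z → z ^ F * (D ^ δ * Y ^ U)) (rising₃-suc b) ⟩
  (D′ * Y) ^ F * (D ^ δ * Y ^ U)       ≤⟨ *-monoʳ-≤ ((D′ * Y) ^ F) (*-monoˡ-≤ (Y ^ U) (^-monoˡ-≤ δ (rising₃-≤-suc b))) ⟩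
  (D′ * Y) ^ F * (D′ ^ δ * Y ^ U)      ≡⟨ cong (_* (D′ ^ δ * Y ^ U)) (^-distribʳ-* D′ Y F) ⟩
  D′ ^ F * Y ^ F * (D′ ^ δ * Y ^ U)    ≡⟨ arith (D′ ^ F) (Y ^ F) (D′ ^ δ) (Y ^ U) ⟩
  D′ ^ F * D′ ^ δ * (Y ^ F * Y ^ U)    ≡⟨ cong₂ _*_ (^-distribˡ-+-* D′ F δ) (^-distribˡ-+-* Y F U) ⟨
  D′ ^ (F + δ) * Y ^ (F + U)           ∎
  where
  open ≤-Reasoning
  D = rising₃ b
  D′ = rising₃ (suc b)
  X = 4 + b
  Y = 1 + b
  arith : ∀ a b c d → a * b * (c * d) ≡ a * c * (b * d)
  arith = solve-∀

-- Greedy extension by the coreset of one label.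

module Coreset {n k : ℕ} (ALG : List (Edge n) → List (Edge n))
  (maximum : (H : List (Edge n)) → IsMaxMatching H (ALG H)) (E : List (Edge n)) where

  ALG-⊆ : ∀ H → ALG H ⊆ H
  ALG-⊆ H = proj₁ (maximum H)

  ALG-matching : ∀ H → Matching (ALG H)
  ALG-matching H = isMatching⁻ _ (proj₁ (proj₂ (maximum H)))

  ALG-length : ∀ H → length (ALG H) ≡ MM H
  ALG-length H = proj₂ (proj₂ (maximum H))

  MM≤length : ∀ H → MM H ≤ length H
  MM≤length H = ≤-trans (≤-reflexive (sym (ALG-length H))) (Sublist.length-mono-≤ (ALG-⊆ H))

  module Stage (M : List (Edge n)) (mM : Matching M) (i : Fin k) (x : Partial (Fin k) (length E)) where

    -- This list is determined before label `i` is revealed. Hence `conflicting?` is the same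
    -- predicate for every choice of `S`, as `∑-revelations-bound` requires of its `P?`.
    known : List (Edge n)
    known = filter (¬? ∘ freeOf? M) (knownPart E x i)

    Conflicting : Edge n → Set
    Conflicting e = ¬ FreeOf (M ++ ALG known) e

    conflicting? : Decidable Conflicting
    conflicting? = ¬? ∘ freeOf? (M ++ ALG known)

    -- Every edge of `known` touches `M`, so the filter introduced in the first step removes nothing
    -- and `length-filter-¬freeOf` applies.
    length-ALG-known : length (ALG known) ≤ 2 * length M
    length-ALG-known = begin
      length (ALG known)
        ≡⟨ cong length (filter-all (¬? ∘ freeOf? M) (All.tabulate λ e∈ →
             proj₂ (∈-filter⁻ (¬? ∘ freeOf? M) {xs = knownPart E x i} (⊆-lookup (ALG-⊆ known) e∈)))) ⟨
      length (filter (¬? ∘ freeOf? M) (ALG known))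
        ≤⟨ length-filter-¬freeOf (ALG-matching known) M ⟩
      2 * length M ∎
      where open ≤-Reasoning

    -- The list `M ++ ALG known` has at most `3 * length M` edges, and each of them meets at most
    -- two edges of the matching `N`.
    length-conflicting : ∀ {N} → Matching N → length (filter conflicting? N) ≤ 6 * length M
    length-conflicting {N} mN = begin
      length (filter conflicting? N)       ≤⟨ length-filter-¬freeOf mN (M ++ ALG known) ⟩
      2 * length (M ++ ALG known)          ≡⟨ cong (2 *_) (length-++ M) ⟩
      2 * (length M + length (ALG known))  ≤⟨ *-monoʳ-≤ 2 (+-monoʳ-≤ (length M) length-ALG-known) ⟩
      2 * (length M + 2 * length M)        ≡⟨ arith (length M) ⟩
      6 * length M                         ∎
      where
      open ≤-Reasoning
      arith : ∀ m → 2 * (m + 2 * m) ≡ 6 * m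
      arith = solve-∀

    extension : Partial (Fin k) (length E) → List (Edge n)
    extension y = filter (freeOf? M) (ALG (knownPart E y i))

    extension-matching : ∀ y → Matching (M ++ extension y)
    extension-matching y = AllPairs.++⁺ mM (AllPairs.filter⁺ (freeOf? M) (ALG-matching _))
      (All.tabulate λ e∈M → All.tabulate λ f∈ →
        Disjoint-sym (All.lookup (proj₂ (∈-filter⁻ (freeOf? M) {xs = ALG (knownPart E y i)} f∈)) e∈M))

    -- Every edge of the maximum matching of the part that touches M either was known before,
    -- and there are at most |ALG known| of those, or is a conflicting newly revealed one; on the other
    -- hand ALG known together with the nonconflicting newly revealed edges is a matching of the part.
    length-revealed : ∀ {y S R} → Matching (unrevealed E x) → Revelation i E x y S R →
      length S ≤ length (extension y) + 2 * length (filter conflicting? S)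
    length-revealed {y} {S} mU r = +-cancelˡ-≤ (length (ALG known)) _ _ (begin
      N₀ + length S                   ≡⟨ cong (N₀ +_) (length-filter-∁ (freeOf? (M ++ ALG known)) S) ⟨
      N₀ + (f + u)                    ≡⟨ arith₁ N₀ f u ⟩
      f + (N₀ + u)                    ≤⟨ +-monoʳ-≤ f lower ⟩
      f + length (ALG G)              ≡⟨ cong (f +_) (length-filter-∁ (freeOf? M) (ALG G)) ⟨
      f + (length touching + ν)       ≤⟨ +-monoʳ-≤ f (+-monoˡ-≤ ν upper) ⟩
      f + (N₀ + f + ν)                ≡⟨ arith₂ N₀ f ν ⟩
      N₀ + (ν + 2 * f)                ∎)
      where
      open ≤-Reasoning
      G = knownPart E y i
      N₀ = length (ALG known)
      ν = length (extension y)
      f = length (filter conflicting? S)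
      S′ = filter (freeOf? (M ++ ALG known)) S
      u = length S′
      touching = filter (¬? ∘ freeOf? M) (ALG G)
      arith₁ : ∀ a b c → a + (b + c) ≡ b + (a + c)
      arith₁ = solve-∀
      arith₂ : ∀ a b c → b + (a + b + c) ≡ a + (c + 2 * b)
      arith₂ = solve-∀
      touching-∈ : ∀ {e} → e ∈ touching → e ∈ known ⊎ e ∈ filter conflicting? S
      touching-∈ e∈ with ∈-filter⁻ (¬? ∘ freeOf? M) e∈
      ... | e∈ALG , ¬free = Sum.map
        (λ e∈K → ∈-filter⁺ (¬? ∘ freeOf? M) e∈K ¬free)
        -- A revealed edge that touches `M` is conflicting, as `M` is a prefix of `M ++ ALG known`.
        (λ e∈S → ∈-filter⁺ conflicting? e∈S (¬free ∘ All.++⁻ˡ M))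
        (knownPart-Revelation r (⊆-lookup (ALG-⊆ G) e∈ALG))
      upper : length touching ≤ N₀ + f
      -- The old touching edges form a matching inside `known`, where the maximum is `N₀`; the new
      -- ones are merely counted.
      upper = ≤-trans
        (Matching⇒length≤MM+MM touching (AllPairs.filter⁺ (¬? ∘ freeOf? M) (ALG-matching G)) (All.tabulate touching-∈))
        (+-mono-≤ (≤-reflexive (sym (ALG-length known))) (MM≤length (filter conflicting? S)))
      matching : Matching (ALG known ++ S′)
      matching = AllPairs.++⁺ (ALG-matching known)
        (AllPairs.filter⁺ (freeOf? (M ++ ALG known)) (AllPairs-⊆ (Revelation-⊆ˡ r) mU))
        (All.tabulate λ a∈ → All.tabulate λ s∈ → Disjoint-sym
          (All.lookup (All.++⁻ʳ M (proj₂ (∈-filter⁻ (freeOf? (M ++ ALG known)) {xs = S} s∈))) a∈))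
      inside : All (_∈ G) (ALG known ++ S′)
      inside = All.++⁺
        (All.tabulate λ a∈ → Revelation-knownPartˡ r
          (proj₁ (∈-filter⁻ (¬? ∘ freeOf? M) {xs = knownPart E x i} (⊆-lookup (ALG-⊆ known) a∈))))
        (All.tabulate λ s∈ → Revelation-knownPartʳ r (proj₁ (∈-filter⁻ (freeOf? (M ++ ALG known)) s∈)))
      lower : N₀ + u ≤ length (ALG G)
      lower = begin
        N₀ + u                    ≡⟨ length-++ (ALG known) ⟨
        length (ALG known ++ S′)  ≤⟨ Matching⇒length≤MM matching inside ⟩
        MM G                      ≡⟨ ALG-length G ⟨
        length (ALG G)            ∎

  -- Induction over the labels.

  partialUnion : Vec (Fin k) (length E) → List (Fin k) → List (Edge n)
  partialUnion p = concatMap (λ i → ALG (part E p i))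

  module _ {Bad : Vec (Fin k) (length E) → Set} (bad? : Decidable Bad) (s : ℕ)
    (Bad⇒≤s : ∀ p → Bad p → MM (coresetUnion ALG E p) ≤ s) where

    private
      -- By `length-conflicting`, this bounds the number of conflicting edges as long as
      -- `length M ≤ s`.
      t = 6 * s

    badCompletions : List (Fin k) → Partial (Fin k) (length E) → ℕ
    badCompletions ls x = ∑-completions ls x (indicator bad?)

    Reached : List (Fin k) → List (Fin k) → Partial (Fin k) (length E) → List (Edge n) → Set
    Reached done ls x M = ∀ p → Completion ls x p → M ⊆ partialUnion p done

    -- For every completion, the union of the coresets contains `M`, whereas in a bad one no
    -- matching exceeds `s`.
    large⇒no-bad : ∀ {done ls x M} → allFin k ≡ done ++ ls → Matching M → Reached done ls x M →
      s < length M → badCompletions ls x ≡ 0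
    large⇒no-bad {done} {ls} {x} {M} eq mM M⊆ s<M = n≤0⇒n≡0 (begin
      badCompletions ls x           ≤⟨ ∑-completions-mono ls x (λ p c → ≤-reflexive (indicator-¬ bad? (not-bad p c))) ⟩
      ∑-completions ls x (λ _ → 0)  ≡⟨ ∑-completions-const ls E x 0 ⟩
      0                             ∎)
      where
      open ≤-Reasoning
      not-bad : ∀ p → Completion ls x p → ¬ Bad p
      not-bad p c bad = <⇒≱ s<M (≤-trans (⊆-Matching⇒length≤MM M⊆U mM) (Bad⇒≤s p bad))
        where
        M⊆U : M ⊆ coresetUnion ALG E p
        M⊆U = subst (M ⊆_) (sym (trans (cong (partialUnion p) eq) (concatMap-++ _ done ls)))
                (Sublist.++⁺ʳ (partialUnion p ls) (M⊆ p c))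

    -- The labels of `ls₁` are to be revealed, those of `ls₂` are the reserve left open;
    -- denominators are cleared. By `length-revealed`, one step lowers the exponent `r + length M`
    -- by at most two per conflicting revealed edge, because the growth of `M` makes up for the
    -- rest.
    badCompletions-bound : ∀ done ls₁ ls₂ x M → allFin k ≡ done ++ ls₁ ++ ls₂ →
      Matching (unrevealed E x) → Matching M → Reached done (ls₁ ++ ls₂) x M →
      let r = length (unrevealed E x)
          h₂ = length ls₂ + length ls₂
          b = length ls₁ + h₂
      in badCompletions (ls₁ ++ ls₂) x * (2 ^ r * 2 ^ length M * rising₃ h₂ ^ t)
           ≤ 2 ^ s * rising₃ b ^ t * b ^ r
    badCompletions-bound done ls₁ ls₂ x M eq mU mM M⊆ with length M ≤? s
    ... | no M≰s rewrite large⇒no-bad {done} {x = x} eq mM M⊆ (≰⇒> M≰s) = z≤n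
    -- All `h ^ r` completions are counted as bad. The weight `2 ^ r` turns this into `(2 * h) ^ r`,
    -- which is why the reserve enters `b` twice.
    badCompletions-bound done [] ls₂ x M eq mU mM M⊆ | yes M≤s = begin
      badCompletions ls₂ x * (2 ^ r * 2 ^ length M * D)  ≤⟨ *-mono-≤ bad≤ (*-monoˡ-≤ D (*-monoʳ-≤ (2 ^ r) (^-monoʳ-≤ 2 M≤s))) ⟩
      h ^ r * (2 ^ r * 2 ^ s * D)                        ≡⟨ arith (h ^ r) (2 ^ r) (2 ^ s) D ⟩
      2 ^ s * D * (2 ^ r * h ^ r)                        ≡⟨ cong (2 ^ s * D *_) (^-distribʳ-* 2 h r) ⟨
      2 ^ s * D * (2 * h) ^ r                            ≡⟨ cong (λ z → 2 ^ s * D * (h + z) ^ r) (+-identityʳ h) ⟩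
      2 ^ s * D * (h + h) ^ r                            ∎
      where
      open ≤-Reasoning
      r = length (unrevealed E x)
      h = length ls₂
      D = rising₃ (h + h) ^ t
      bad≤ : badCompletions ls₂ x ≤ h ^ r
      bad≤ = ≤-trans (∑-completions-mono ls₂ x (λ p _ → indicator-≤1 bad? p))
               (≤-reflexive (trans (∑-completions-const ls₂ E x 1) (*-identityˡ _)))
      arith : ∀ a b c d → a * (b * c * d) ≡ c * d * (b * a)
      arith = solve-∀
    badCompletions-bound done (i ∷ ls₁) ls₂ x M eq mU mM M⊆ | yes M≤s = begin
      badCompletions (i ∷ ls) x * c
        ≡⟨ cong (_* c) (∑-completions-∷ i ls x (indicator bad?)) ⟩
      ∑-revelations i x (badCompletions ls) * c
        -- The value 4 is `2 ^ 2`, for the two units of the exponent lost per conflicting revealed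
        -- edge.
        ≤⟨ ∑-revelations-bound conflicting? i 4 b c K E x (badCompletions ls) revelation ⟩
      K * ((4 + b) ^ length (filter conflicting? U) * (1 + b) ^ length (filter (¬? ∘ conflicting?) U))
        ≡⟨ *-assoc (2 ^ s) (rising₃ b ^ t) _ ⟩
      2 ^ s * (rising₃ b ^ t * ((4 + b) ^ length (filter conflicting? U) * (1 + b) ^ length (filter (¬? ∘ conflicting?) U)))
        ≤⟨ *-monoʳ-≤ (2 ^ s) (rising₃-step b (≤-trans (length-conflicting mU) (*-monoʳ-≤ 6 M≤s))
             (trans (+-comm (length (filter conflicting? U)) _) (length-filter-∁ conflicting? U))) ⟩
      2 ^ s * (rising₃ (1 + b) ^ t * (1 + b) ^ length U)
        ≡⟨ *-assoc (2 ^ s) (rising₃ (1 + b) ^ t) _ ⟨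
      2 ^ s * rising₃ (1 + b) ^ t * (1 + b) ^ length U ∎
      where
      open ≤-Reasoning
      open Stage M mM i x
      ls = ls₁ ++ ls₂
      U = unrevealed E x
      μ = length M
      h₂ = length ls₂ + length ls₂
      b = length ls₁ + h₂
      D = rising₃ h₂ ^ t
      c = 2 ^ length U * 2 ^ μ * D
      K = 2 ^ s * rising₃ b ^ t
      i∉ls : i ∉ ls
      -- `allFin k` lists each label once, so `i` cannot be drawn again later.
      i∉ls = Unique[x∷xs]⇒x∉xs (AllPairs-⊆ (Sublist.++⁺ˡ done ⊆-refl) (subst Unique eq (allFin⁺ k)))
      revelation : ∀ {y S R} → Revelation i E x y S R →
        badCompletions ls y * c ≤ K * (4 ^ length (filter conflicting? S) * b ^ length R)
      revelation {y} {S} {R} r = begin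
        g * (2 ^ length U * 2 ^ μ * D)                    ≡⟨ cong (λ z → g * (z * D)) (^-distribˡ-+-* 2 (length U) μ) ⟨
        g * (2 ^ (length U + μ) * D)                      ≤⟨ *-monoʳ-≤ g (*-monoˡ-≤ D (^-monoʳ-≤ 2 exponent)) ⟩
        g * (2 ^ (2 * f + (ρ + length M′)) * D)           ≡⟨ cong (λ z → g * (z * D)) powers ⟩
        g * (4 ^ f * (2 ^ ρ * 2 ^ length M′) * D)         ≡⟨ arith₁ g (4 ^ f) (2 ^ ρ * 2 ^ length M′) D ⟩
        4 ^ f * (g * (2 ^ ρ * 2 ^ length M′ * D))         ≤⟨ *-monoʳ-≤ (4 ^ f) ih ⟩
        4 ^ f * (K * b ^ ρ)                               ≡⟨ arith₂ (4 ^ f) K (b ^ ρ) ⟩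
        K * (4 ^ f * b ^ ρ)                               ∎
        where
        g = badCompletions ls y
        f = length (filter conflicting? S)
        ρ = length R
        M′ = M ++ extension y
        U≡R = Revelation-unrevealed r
        exponent : length U + μ ≤ 2 * f + (ρ + length M′)
        exponent = begin
          length U + μ                                     ≡⟨ cong (_+ μ) (Revelation-length r) ⟨
          length S + ρ + μ                                 ≤⟨ +-monoˡ-≤ μ (+-monoˡ-≤ ρ (length-revealed mU r)) ⟩
          length (extension y) + 2 * f + ρ + μ             ≡⟨ arith (length (extension y)) (2 * f) ρ μ ⟩
          2 * f + (ρ + (μ + length (extension y)))         ≡⟨ cong (λ z → 2 * f + (ρ + z)) (length-++ M) ⟨
          2 * f + (ρ + length M′)                          ∎
          where
          arith : ∀ a b c d → a + b + c + d ≡ b + (c + (d + a))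
          arith = solve-∀
        powers : 2 ^ (2 * f + (ρ + length M′)) ≡ 4 ^ f * (2 ^ ρ * 2 ^ length M′)
        powers = trans (^-distribˡ-+-* 2 (2 * f) _)
          (cong₂ _*_ (sym (^-*-assoc 2 2 f)) (^-distribˡ-+-* 2 ρ (length M′)))
        arith₁ : ∀ a b c d → a * (b * c * d) ≡ b * (a * (c * d))
        arith₁ = solve-∀
        arith₂ : ∀ a b c → a * (b * c) ≡ b * (a * c)
        arith₂ = solve-∀
        M′⊆ : Reached (done ++ [ i ]) ls y M′
        M′⊆ p comp = subst (M′ ⊆_) (sym (concatMap-++ _ done [ i ]))
          -- The old `M` lies in the coresets of `done`, and the extension in the coreset of `i`,
          -- whose part is already final.
          (Sublist.++⁺ (M⊆ p (Revelation-Completion r comp))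
            (subst (extension y ⊆_)
              (sym (trans (++-identityʳ _) (cong ALG (part≡knownPart i∉ls E comp))))
              (Sublist.filter-⊆ (freeOf? M) (ALG (knownPart E y i)))))
        ih : g * (2 ^ ρ * 2 ^ length M′ * D) ≤ K * b ^ ρ
        ih = subst (λ z → g * (2 ^ length z * 2 ^ length M′ * D) ≤ K * b ^ length z) U≡R
          (badCompletions-bound (done ++ [ i ]) ls₁ ls₂ y M′
            (trans eq (sym (++-assoc done [ i ] ls)))
            (subst Matching (sym U≡R) (AllPairs-⊆ (Revelation-⊆ʳ r) mU))
            (extension-matching y) M′⊆)

-- Numerical estimates.

-- The doubled exponent absorbs the rounding. If `n` exceeded this power, taking logarithms would
-- give `2 * ⌊log₂ n ⌋ ≤ ⌊log₂ n ⌋`, which is impossible since the logarithm is positive from 2 on.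
n≤2^2⌊log₂n⌋ : ∀ n → n ≤ 2 ^ (2 * ⌊log₂ n ⌋)
n≤2^2⌊log₂n⌋ zero    = z≤n
n≤2^2⌊log₂n⌋ 1       = s≤s z≤n
n≤2^2⌊log₂n⌋ n@(suc (suc _)) with n ≤? 2 ^ (2 * ⌊log₂ n ⌋)
... | yes n≤ = n≤
... | no n≰ = contradiction too-small (<⇒≱ (m<m+n ⌊log₂ n ⌋ (⌊log₂⌋-mono-≤ {2} {n} (s≤s (s≤s z≤n)))))
  where
  too-small : ⌊log₂ n ⌋ + ⌊log₂ n ⌋ ≤ ⌊log₂ n ⌋
  too-small = begin
    ⌊log₂ n ⌋ + ⌊log₂ n ⌋           ≡⟨ cong (⌊log₂ n ⌋ +_) (+-identityʳ ⌊log₂ n ⌋) ⟨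
    2 * ⌊log₂ n ⌋                   ≡⟨ ⌊log₂[2^n]⌋≡n (2 * ⌊log₂ n ⌋) ⟨
    ⌊log₂ 2 ^ (2 * ⌊log₂ n ⌋) ⌋     ≤⟨ ⌊log₂⌋-mono-≤ (<⇒≤ (≰⇒> n≰)) ⟩
    ⌊log₂ n ⌋                       ∎
    where open ≤-Reasoning

-- Each of the three linear factors at most doubles, which gives the 8.
rising₃-doubling : ∀ a b → b ≤ 1 + 2 * a → rising₃ b ≤ 8 * rising₃ a
rising₃-doubling a b b≤ = begin
  (1 + b) * (2 + b) * (3 + b)
    ≤⟨ *-mono-≤ (*-mono-≤ (bound 0) (bound 1)) (bound 2) ⟩
  (2 * (1 + a)) * (2 * (2 + a)) * (2 * (3 + a))
    ≡⟨ arith (1 + a) (2 + a) (3 + a) ⟩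
  8 * rising₃ a ∎
  where
  open ≤-Reasoning
  arith : ∀ x y z → (2 * x) * (2 * y) * (2 * z) ≡ 8 * (x * y * z)
  arith = solve-∀
  shifted : ∀ j a → suc j + (1 + 2 * a) + j ≡ 2 * (suc j + a)
  shifted = solve-∀
  bound : ∀ j → suc j + b ≤ 2 * (suc j + a)
  bound j = ≤-trans (+-monoʳ-≤ (suc j) b≤) (≤-trans (m≤m+n _ j) (≤-reflexive (shifted j a)))

-- One factor 2 is paid for by five factors `4 / 3`: `2 * 3 ^ 5 = 486` is below `4 ^ 5 = 1024`, with
-- difference 538.
2^w*3^m≤4^m : ∀ w m → 5 * w ≤ m → 2 ^ w * 3 ^ m ≤ 4 ^ m
2^w*3^m≤4^m w m 5w≤m with m≤n⇒∃[o]m+o≡n 5w≤m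
... | d , refl = begin
  2 ^ w * 3 ^ (5 * w + d)          ≡⟨ cong (2 ^ w *_) (^-distribˡ-+-* 3 (5 * w) d) ⟩
  2 ^ w * (3 ^ (5 * w) * 3 ^ d)    ≡⟨ *-assoc (2 ^ w) _ _ ⟨
  2 ^ w * 3 ^ (5 * w) * 3 ^ d      ≡⟨ cong (λ z → 2 ^ w * z * 3 ^ d) (^-*-assoc 3 5 w) ⟨
  2 ^ w * (3 ^ 5) ^ w * 3 ^ d      ≡⟨ cong (_* 3 ^ d) (^-distribʳ-* 2 (3 ^ 5) w) ⟨
  (2 * 3 ^ 5) ^ w * 3 ^ d          ≤⟨ *-mono-≤ (^-monoˡ-≤ w (m≤m+n (2 * 3 ^ 5) 538)) (^-monoˡ-≤ d (n≤1+n 3)) ⟩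
  (4 ^ 5) ^ w * 4 ^ d              ≡⟨ cong (_* 4 ^ d) (^-*-assoc 4 5 w) ⟩
  4 ^ (5 * w) * 4 ^ d              ≡⟨ ^-distribˡ-+-* 4 (5 * w) d ⟨
  4 ^ (5 * w + d)                  ∎
  where open ≤-Reasoning

-- The bound on the number of bad assignments.

module _ {n k : ℕ} (1≤k : 1 ≤ k) (ALG : List (Edge n) → List (Edge n))
  (maximum : (H : List (Edge n)) → IsMaxMatching H (ALG H)) (E : List (Edge n)) where

  open Coreset {k = k} ALG maximum E

  private
    m = MM E

  module _ {Bad : Vec (Fin k) (length E) → Set} (bad? : Decidable Bad) (s : ℕ)
    (Bad⇒≤s : ∀ p → Bad p → MM (coresetUnion ALG E p) ≤ s) where

    -- The labels outside `ALG E` are fixed, and the induction starts from the empty matching.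
    -- Divided by `4 ^ m * k ^ m`, the estimate bounds the conditional failure probability by
    -- `2 ^ (19 * s) * (3 / 4) ^ m`.
    ∑-completions-bad : ∀ x → unrevealed E x ≡ ALG E →
      ∑-completions (allFin k) x (indicator bad?) * 4 ^ m ≤ 2 ^ (19 * s) * (3 ^ m * k ^ m)
    ∑-completions-bad x U≡ = begin
      N * (2 * 2) ^ m                        ≡⟨ cong (N *_) (^-distribʳ-* 2 2 m) ⟩
      N * (2 ^ m * 2 ^ m)                    ≡⟨ *-assoc N (2 ^ m) _ ⟨
      N * 2 ^ m * 2 ^ m                      ≤⟨ *-monoˡ-≤ (2 ^ m) halved ⟩
      2 ^ s * 8 ^ t * b ^ m * 2 ^ m          ≡⟨ arith₁ (2 ^ s * 8 ^ t) (b ^ m) (2 ^ m) ⟩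
      2 ^ s * 8 ^ t * (2 ^ m * b ^ m)        ≡⟨ cong₂ _*_ powers (sym (^-distribʳ-* 2 b m)) ⟩
      2 ^ (19 * s) * (2 * b) ^ m             ≤⟨ *-monoʳ-≤ (2 ^ (19 * s)) (^-monoˡ-≤ m 2b≤3k) ⟩
      2 ^ (19 * s) * (3 * k) ^ m             ≡⟨ cong (2 ^ (19 * s) *_) (^-distribʳ-* 3 k m) ⟩
      2 ^ (19 * s) * (3 ^ m * k ^ m)         ∎
      where
      open ≤-Reasoning
      N = ∑-completions (allFin k) x (indicator bad?)
      t = 6 * s
      h = ⌊ k /2⌋
      d = ⌈ k /2⌉
      -- This equals `k + h`. A reserve proportional to `k` keeps the ratio of the two values of
      -- `rising₃` bounded, while `b` stays below `2 * k`.
      b = d + (h + h)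
      h+d≡k : h + d ≡ k
      h+d≡k = ⌊n/2⌋+⌈n/2⌉≡n k
      ls₁ = take d (allFin k)
      ls₂ = drop d (allFin k)
      length-ls₁ : length ls₁ ≡ d
      length-ls₁ = trans (length-take d (allFin k)) (trans (cong (d ⊓_) (length-tabulate {n = k} id)) (m≤n⇒m⊓n≡m (⌈n/2⌉≤n k)))
      length-ls₂ : length ls₂ ≡ h
      length-ls₂ = trans (length-drop d (allFin k)) (trans (cong (_∸ d) (trans (length-tabulate {n = k} id) (sym h+d≡k))) (m+n∸n≡m h d))
      length-U : length (unrevealed E x) ≡ m
      length-U = trans (cong length U≡) (ALG-length E)
      D = rising₃ (h + h) ^ t
      -- The summand `1` matters at `k = 1`, where `h = 0` and `b = 1`.
      b≤ : b ≤ 1 + 2 * (h + h)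
      b≤ = ≤-trans (+-monoˡ-≤ (h + h) d≤) (≤-trans (m≤m+n _ h) (≤-reflexive (arith h)))
        where
        d≤ : d ≤ 1 + h
        d≤ = ⌈n/2⌉≤1+⌊n/2⌋ k
          where
          ⌈n/2⌉≤1+⌊n/2⌋ : ∀ n → ⌈ n /2⌉ ≤ 1 + ⌊ n /2⌋
          ⌈n/2⌉≤1+⌊n/2⌋ 0 = z≤n
          ⌈n/2⌉≤1+⌊n/2⌋ 1 = s≤s z≤n
          ⌈n/2⌉≤1+⌊n/2⌋ (suc (suc n)) = s≤s (⌈n/2⌉≤1+⌊n/2⌋ n)
        arith : ∀ h → 1 + h + (h + h) + h ≡ 1 + 2 * (h + h)
        arith = solve-∀
      2b≤3k : 2 * b ≤ 3 * k
      2b≤3k = begin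
        2 * (d + (h + h))       ≡⟨ arith d h ⟩
        2 * (h + d) + (h + h)   ≤⟨ +-monoʳ-≤ (2 * (h + d)) (+-monoʳ-≤ h (⌊n/2⌋≤⌈n/2⌉ k)) ⟩
        2 * (h + d) + (h + d)   ≡⟨ arith′ (h + d) ⟩
        3 * (h + d)             ≡⟨ cong (3 *_) h+d≡k ⟩
        3 * k                   ∎
        where
        arith : ∀ d h → 2 * (d + (h + h)) ≡ 2 * (h + d) + (h + h)
        arith = solve-∀
        arith′ : ∀ x → 2 * x + x ≡ 3 * x
        arith′ = solve-∀
      -- The 19 collects `s` from `2 ^ s` and `3 * (6 * s)` from `8 ^ t`.
      powers : 2 ^ s * 8 ^ t ≡ 2 ^ (19 * s)
      powers = trans (cong (2 ^ s *_) (^-*-assoc 2 3 t))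
        (trans (sym (^-distribˡ-+-* 2 s (3 * t))) (cong (2 ^_) (arith s)))
        where
        arith : ∀ s → s + 3 * (6 * s) ≡ 19 * s
        arith = solve-∀
      arith₁ : ∀ a b c → a * b * c ≡ a * (c * b)
      arith₁ = solve-∀
      -- The factor `1` is `2 ^ length []`, from the empty initial matching.
      raw : N * (2 ^ m * 1 * D) ≤ 2 ^ s * rising₃ b ^ t * b ^ m
      raw = subst (λ l → ∑-completions l x (indicator bad?) * (2 ^ m * 1 * D) ≤ 2 ^ s * rising₃ b ^ t * b ^ m)
              (take++drop≡id d (allFin k)) step
        where
        step : ∑-completions (ls₁ ++ ls₂) x (indicator bad?) * (2 ^ m * 1 * D) ≤ 2 ^ s * rising₃ b ^ t * b ^ m
        step with badCompletions-bound bad? s Bad⇒≤s [] ls₁ ls₂ x [] (sym (take++drop≡id d (allFin k)))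
                    (subst Matching (sym U≡) (ALG-matching E)) [] (λ p c → [])
        ... | bound rewrite length-U | length-ls₁ | length-ls₂ = bound
      halved : N * 2 ^ m ≤ 2 ^ s * 8 ^ t * b ^ m
      halved = *-cancelʳ-≤ _ _ D {{m^n≢0 (rising₃ (h + h)) t}} (begin
        N * 2 ^ m * D                           ≡⟨ arith₂ N (2 ^ m) D ⟩
        N * (2 ^ m * 1 * D)                     ≤⟨ raw ⟩
        2 ^ s * rising₃ b ^ t * b ^ m           ≤⟨ *-monoˡ-≤ (b ^ m) (*-monoʳ-≤ (2 ^ s) (^-monoˡ-≤ t (rising₃-doubling (h + h) b b≤))) ⟩
        2 ^ s * (8 * rising₃ (h + h)) ^ t * b ^ m ≡⟨ cong (λ z → 2 ^ s * z * b ^ m) (^-distribʳ-* 8 (rising₃ (h + h)) t) ⟩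
        2 ^ s * (8 ^ t * D) * b ^ m             ≡⟨ arith₃ (2 ^ s) (8 ^ t) D (b ^ m) ⟩
        2 ^ s * 8 ^ t * b ^ m * D               ∎)
        where
        arith₂ : ∀ a b c → a * b * c ≡ a * (b * 1 * c)
        arith₂ = solve-∀
        arith₃ : ∀ a b c d → a * (b * c) * d ≡ a * b * d * c
        arith₃ = solve-∀

  -- `2^w*3^m≤4^m` is used with `w = u + 19 * s` and needs `10 * u + 190 * s ≤ 2 * m`. One `m` pays
  -- for `n ^ c ≤ 2 ^ u`, where `10 * u = 20 * c * ⌊log₂ n ⌋`; the other pays for `s = m / 190`.
  badCount-bound : (c : ℕ) → 20 * c * k * ⌊log₂ n ⌋ ≤ m → badCount k 190 ALG E * n ^ c ≤ totalCount k E
  badCount-bound c large = begin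
    badCount k 190 ALG E * n ^ c     ≡⟨ cong (_* n ^ c) (length-filter≡∑ bad? (assignments k (length E))) ⟩
    β * n ^ c                        ≤⟨ *-cancelʳ-≤ _ _ (4 ^ m) {{m^n≢0 4 m}} scaled ⟩
    k ^ length E                     ≡⟨ length-assignments k (length E) ⟨
    totalCount k E                   ∎
    where
    open ≤-Reasoning
    instance
      k≢0 : NonZero k
      k≢0 = >-nonZero 1≤k
    bad? : Decidable (λ p → 190 * MM (coresetUnion ALG E p) < m)
    bad? p = 190 * MM (coresetUnion ALG E p) <? m
    β = ∑ (assignments k (length E)) (indicator bad?)
    s = m / 190
    Bad⇒≤s : ∀ p → 190 * MM (coresetUnion ALG E p) < m → MM (coresetUnion ALG E p) ≤ s
    Bad⇒≤s p bad = subst (_≤ s) (m*n/n≡m U 190) (/-monoˡ-≤ 190 (≤-trans (≤-reflexive (*-comm U 190)) (<⇒≤ bad)))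
      where U = MM (coresetUnion ALG E p)
    -- `ALG E` is itself a maximum matching of `E`, so it can serve as the matching whose labels
    -- remain random.
    averaged : β * 4 ^ m * k ^ m ≤ k ^ length E * (2 ^ (19 * s) * (3 ^ m * k ^ m))
    averaged = subst (λ l → β * 4 ^ m * k ^ l ≤ k ^ length E * (2 ^ (19 * s) * (3 ^ m * k ^ m))) (ALG-length E)
      (∑-assignments-bound (ALG-⊆ E) (indicator bad?) (4 ^ m) _ (∑-completions-bad bad? s Bad⇒≤s))
    cancelled : β * 4 ^ m ≤ k ^ length E * (2 ^ (19 * s) * 3 ^ m)
    cancelled = *-cancelʳ-≤ _ _ (k ^ m) {{m^n≢0 k m}} (≤-trans averaged
      (≤-reflexive (arith (k ^ length E) (2 ^ (19 * s)) (3 ^ m) (k ^ m))))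
      where
      arith : ∀ a b c d → a * (b * (c * d)) ≡ a * (b * c) * d
      arith = solve-∀
    u = 2 * ⌊log₂ n ⌋ * c
    n^c≤2^u : n ^ c ≤ 2 ^ u
    n^c≤2^u = ≤-trans (^-monoˡ-≤ c (n≤2^2⌊log₂n⌋ n)) (≤-reflexive (^-*-assoc 2 (2 * ⌊log₂ n ⌋) c))
    10u≤m : 10 * u ≤ m
    10u≤m = begin
      10 * (2 * ⌊log₂ n ⌋ * c)         ≡⟨ arith ⌊log₂ n ⌋ c ⟩
      20 * c * 1 * ⌊log₂ n ⌋           ≤⟨ *-monoˡ-≤ ⌊log₂ n ⌋ (*-monoʳ-≤ (20 * c) 1≤k) ⟩
      20 * c * k * ⌊log₂ n ⌋           ≤⟨ large ⟩
      m                                ∎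
      where
      arith : ∀ l c → 10 * (2 * l * c) ≡ 20 * c * 1 * l
      arith = solve-∀
    exponent : 5 * (u + 19 * s) ≤ m
    exponent = *-cancelˡ-≤ 2 (begin
      2 * (5 * (u + 19 * s))   ≡⟨ arith u s ⟩
      10 * u + s * 190         ≤⟨ +-mono-≤ 10u≤m (m/n*n≤m m 190) ⟩
      m + m                    ≡⟨ cong (m +_) (+-identityʳ m) ⟨
      2 * m                    ∎)
      where
      arith : ∀ u s → 2 * (5 * (u + 19 * s)) ≡ 10 * u + s * 190
      arith = solve-∀
    scaled : β * n ^ c * 4 ^ m ≤ k ^ length E * 4 ^ m
    scaled = begin
      β * n ^ c * 4 ^ m                                    ≡⟨ arith₁ β (n ^ c) (4 ^ m) ⟩
      n ^ c * (β * 4 ^ m)                                  ≤⟨ *-mono-≤ n^c≤2^u cancelled ⟩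
      2 ^ u * (k ^ length E * (2 ^ (19 * s) * 3 ^ m))      ≡⟨ arith₂ (2 ^ u) (k ^ length E) (2 ^ (19 * s)) (3 ^ m) ⟩
      k ^ length E * (2 ^ u * 2 ^ (19 * s) * 3 ^ m)        ≡⟨ cong (λ z → k ^ length E * (z * 3 ^ m)) (^-distribˡ-+-* 2 u (19 * s)) ⟨
      k ^ length E * (2 ^ (u + 19 * s) * 3 ^ m)            ≤⟨ *-monoʳ-≤ (k ^ length E) (2^w*3^m≤4^m (u + 19 * s) m exponent) ⟩
      k ^ length E * 4 ^ m                                 ∎
      where
      arith₁ : ∀ a b c → a * b * c ≡ b * (a * c)
      arith₁ = solve-∀
      arith₂ : ∀ a b c d → a * (b * (c * d)) ≡ b * (a * c * d)
      arith₂ = solve-∀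

theorem1 : Σ ℕ λ C → (c : ℕ) → Σ ℕ λ L →
    (n k : ℕ) → 1 ≤ k → (G : Graph n) →
    L * k * ⌊log₂ n ⌋ ≤ MM (edges G) →
    (ALG : List (Edge n) → List (Edge n)) →
    ((H : List (Edge n)) → IsMaxMatching H (ALG H)) →
    ((H : List (Edge n)) → length (ALG H) ≤ n)
    × (badCount k C ALG (edges G) * n ^ c ≤ totalCount k (edges G))
-- The factor 190 is fixed before `c`; the desired failure probability `n ^ (-c)` affects only the
-- threshold `20 * c`.
theorem1 = 190 , λ c → 20 * c , λ n k 1≤k G large ALG maximum →
  (λ H → Matching⇒length≤ (isMatching⁻ (ALG H) (proj₁ (proj₂ (maximum H))))) ,
  badCount-bound 1≤k ALG maximum (edges G) c large
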